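{- Let $G$ be a connected vertex-transitive graph with $|V(G)|\geq 3$. Then every induced path of length at most $2$ in $G$ closes to an induced cycle. Moreover, for every integer $\ell\geq 3$ there exist infinitely many connected vertex-transitive graphs each containing an induced path of length $\ell$ that does not close to an induced cycle.
   Context: All graphs are finite, simple and undirected, and graphs are considered up to isomorphism. A path of length $\ell$ in $G$ is a sequence $(x_0,\dots,x_\ell)$ of pairwise distinct vertices with $x_i x_{i+1}\in E(G)$ for $0\le i\le \ell-1$ (length $0$ means a single vertex). A cycle is a sequence $(x_0,\dots,x_{\ell-1},x_\ell=x_0)$ with $\ell\ge 3$, $x_0,\dots,x_{\ell-1}$ pairwise distinct and $x_ix_{i+1}\in E(G)$ for all $0\le i\le\ell-1$. Paths and cycles are identified with the subgraphs formed by their vertices and edges; a path or cycle is induced if this subgraph is an induced subgraph of $G$. An induced path $P$ closes to an induced cycle if there exists an induced cycle $C$ in $G$ such that $P$ is an induced subgraph of $C$. A graph is vertex-transitive if its automorphism group acts transitively on its vertices. -}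

module Defs where

open import Data.Nat using (ℕ; zero; suc; _≤_)
open import Data.Fin using (Fin; zero; suc; inject₁; fromℕ)
open import Data.Fin.Permutation using (Permutation′; _⟨$⟩ʳ_)
open import Data.Bool using (Bool; true; false)
open import Data.Product using (Σ; ∃; _×_; _,_)
open import Data.Sum using (_⊎_)
open import Relation.Binary.PropositionalEquality using (_≡_)

record Graph : Set where
  field
    n      : ℕ
    adj    : Fin n → Fin n → Bool
    adj-sym    : ∀ u v → adj u v ≡ adj v u
    adj-irrefl : ∀ v → adj v v ≡ false

open Graph public

V : Graph → Set
V G = Fin (n G)

Adj : (G : Graph) → V G → V G → Set
Adj G u v = adj G u v ≡ true

data Reach (G : Graph) : V G → V G → Set where
  here : ∀ {u} → Reach G u u
  step : ∀ {u w v} → Adj G u w → Reach G w v → Reach G u v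

Connected : Graph → Set
Connected G = ∀ u v → Reach G u v

IsAutomorphism : (G : Graph) → Permutation′ (n G) → Set
IsAutomorphism G σ = ∀ x y → adj G (σ ⟨$⟩ʳ x) (σ ⟨$⟩ʳ y) ≡ adj G x y

VertexTransitive : Graph → Set
VertexTransitive G = ∀ u v →
  Σ (Permutation′ (n G)) λ σ → IsAutomorphism G σ × (σ ⟨$⟩ʳ u ≡ v)

SeqVertex : {G : Graph} (ℓ : ℕ) → (Fin (suc ℓ) → V G) → V G → Set
SeqVertex ℓ x v = ∃ λ (i : Fin (suc ℓ)) → x i ≡ v

SeqEdge : {G : Graph} (ℓ : ℕ) → (Fin (suc ℓ) → V G) → V G → V G → Set
SeqEdge ℓ x u v = ∃ λ (i : Fin ℓ) →
  ((u ≡ x (inject₁ i)) × (v ≡ x (suc i))) ⊎ ((v ≡ x (inject₁ i)) × (u ≡ x (suc i)))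

record Path (G : Graph) (ℓ : ℕ) : Set where
  field
    vtx      : Fin (suc ℓ) → V G
    distinct : ∀ i j → vtx i ≡ vtx j → i ≡ j
    edges    : ∀ (i : Fin ℓ) → Adj G (vtx (inject₁ i)) (vtx (suc i))

open Path public

record Cycle (G : Graph) (ℓ : ℕ) : Set where
  field
    long     : 3 ≤ ℓ
    cvtx     : Fin (suc ℓ) → V G
    closed   : cvtx (fromℕ ℓ) ≡ cvtx zero
    cdistinct : ∀ (i j : Fin ℓ) → cvtx (inject₁ i) ≡ cvtx (inject₁ j) → i ≡ j
    cedges   : ∀ (i : Fin ℓ) → Adj G (cvtx (inject₁ i)) (cvtx (suc i))

open Cycle public

InducedPath : {G : Graph} {ℓ : ℕ} → Path G ℓ → Set
InducedPath {G} {ℓ} P =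
  ∀ i j → Adj G (vtx P i) (vtx P j) → SeqEdge {G} ℓ (vtx P) (vtx P i) (vtx P j)

InducedCycle : {G : Graph} {ℓ : ℕ} → Cycle G ℓ → Set
InducedCycle {G} {ℓ} C =
  ∀ i j → Adj G (cvtx C i) (cvtx C j) → SeqEdge {G} ℓ (cvtx C) (cvtx C i) (cvtx C j)

InducedSubgraphOf : {G : Graph} {ℓ m : ℕ} → Path G ℓ → Cycle G m → Set
InducedSubgraphOf {G} {ℓ} {m} P C =
  (∀ i → SeqVertex {G} m (cvtx C) (vtx P i)) ×
  (∀ i j → (SeqEdge {G} ℓ (vtx P) (vtx P i) (vtx P j) → SeqEdge {G} m (cvtx C) (vtx P i) (vtx P j))
         × (SeqEdge {G} m (cvtx C) (vtx P i) (vtx P j) → SeqEdge {G} ℓ (vtx P) (vtx P i) (vtx P j)))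

ClosesToInducedCycle : {G : Graph} {ℓ : ℕ} → Path G ℓ → Set
ClosesToInducedCycle {G} P =
  Σ ℕ λ m → Σ (Cycle G m) λ C → InducedCycle C × InducedSubgraphOf P C

{-# OPTIONS --safe #-}

-- First part.  Let u, w be distinct neighbours of v.  A shortest path from u to w among u, w and
-- the non-neighbours of v forms with v an induced cycle.  If there is none, equality of degrees
-- gives neighbours y of u and x of w in different components of G - N[v], say with that of x not
-- larger than that of y.  Every component of G - N[v] larger than that of y survives inside a
-- component of G - N[x], and the component of y grows by u, so more vertices lie in
-- components of more than that size for x than for v, contradicting vertex-transitivity.
--
-- Second part.  In the circulant graph on ℤ/((ℓ - 1) k + 3) with connection set {±1, …, ±k}, k ≥ 2,
-- the path with steps 1, k, …, k, 1 is induced, and every neighbour of its end other than its last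
-- but one vertex is adjacent to an interior vertex, so no induced cycle leaves the end.

module Submission where

open import Defs
open import Data.Bool using (true; if_then_else_)
import Data.Bool.Properties as Bool
open import Data.Empty using (⊥-elim)
open import Data.Fin using (Fin; zero; suc; toℕ; fromℕ; fromℕ<; inject₁)
open import Data.Fin.Induction using (<-weakInduction)
open import Data.Fin.Permutation using (Permutation′; permutation; id; flip; _∘ₚ_; _⟨$⟩ʳ_; _⟨$⟩ˡ_; inverseˡ; inverseʳ)
open import Data.Fin.Properties using (_≟_; any?; injective⇒≤; toℕ<n; toℕ-injective; toℕ-fromℕ; toℕ-fromℕ<; toℕ-inject₁; fromℕ≢inject₁)
open import Data.Fin.Relation.Unary.Top using (view; view-fromℕ; view-inject₁; ‵fromℕ; ‵inject₁)
open import Data.Nat using (ℕ; zero; suc; _+_; _*_; _∸_; _⊓_; _≤_; _<_; z≤n; s≤s; s≤s⁻¹; s<s)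
open import Data.Nat.Induction using (<-rec)
open import Data.Nat.Properties hiding (_≟_)
open import Data.Nat.Tactic.RingSolver using (solve-∀)
open import Data.Product using (Σ; ∃; _×_; _,_; proj₁; proj₂)
open import Data.Sum using (_⊎_; inj₁; inj₂; swap)
open import Data.Sum.Function.Propositional using (_⊎-⇔_)
open import Function using (_∘_; case_of_; _⇔_; mk⇔)
open import Level using (0ℓ)
open import Relation.Binary using (Rel; Decidable; Symmetric; tri<; tri≈; tri>)
open import Relation.Binary.PropositionalEquality using (_≡_; _≢_; refl; sym; trans; cong; subst; subst₂)
open import Relation.Nullary using (Dec; yes; no; does; ¬_; ¬?; contradiction)
open import Relation.Nullary.Decidable using (map′; dec-true; dec-false; does-⇔; _×-dec_; _⊎-dec_; decidable-stable)
import Relation.Unary as Unary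

open import Algebra.Properties.CommutativeMonoid.Sum +-0-commutativeMonoid
  using (sum; sum-permute; sum-cong-≗)

-- Counting in finite sets.

private variable
  A : Set
  sz : ℕ
  P Q : Fin sz → Set

count : Unary.Decidable P → ℕ
count P? = sum λ i → if does (P? i) then 1 else 0

count-mono : (P? : Unary.Decidable P) (Q? : Unary.Decidable Q) →
  (∀ i → P i → Q i) → count P? ≤ count Q?
count-mono {zero}  P? Q? P⊆Q = z≤n
count-mono {suc sz} P? Q? P⊆Q with P? zero | Q? zero
... | yes p | yes q = s≤s (count-mono (P? ∘ suc) (Q? ∘ suc) (P⊆Q ∘ suc))
... | yes p | no ¬q = contradiction (P⊆Q zero p) ¬q
... | no ¬p | yes q = m≤n⇒m≤1+n (count-mono (P? ∘ suc) (Q? ∘ suc) (P⊆Q ∘ suc))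
... | no ¬p | no ¬q = count-mono (P? ∘ suc) (Q? ∘ suc) (P⊆Q ∘ suc)

count-mono-< : (P? : Unary.Decidable P) (Q? : Unary.Decidable Q) →
  (∀ i → P i → Q i) → ∀ i → ¬ P i → Q i → count P? < count Q?
count-mono-< P? Q? P⊆Q zero ¬p q with P? zero | Q? zero
... | yes p | _     = contradiction p ¬p
... | no _  | yes _ = s≤s (count-mono (P? ∘ suc) (Q? ∘ suc) (P⊆Q ∘ suc))
... | no _  | no ¬q = contradiction q ¬q
count-mono-< P? Q? P⊆Q (suc i) ¬p q with P? zero | Q? zero
... | yes p | yes _ = s<s (count-mono-< (P? ∘ suc) (Q? ∘ suc) (P⊆Q ∘ suc) i ¬p q)
... | yes p | no ¬q = contradiction (P⊆Q zero p) ¬q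
... | no _  | yes _ = m<n⇒m<1+n (count-mono-< (P? ∘ suc) (Q? ∘ suc) (P⊆Q ∘ suc) i ¬p q)
... | no _  | no _  = count-mono-< (P? ∘ suc) (Q? ∘ suc) (P⊆Q ∘ suc) i ¬p q

-- Applied to an automorphism, this makes every count defined from adjacency alone the same at all
-- vertices of a vertex-transitive graph.
count-permute : (P? : Unary.Decidable P) (Q? : Unary.Decidable Q) (π : Permutation′ sz) →
  (∀ i → P i ⇔ Q (π ⟨$⟩ʳ i)) → count P? ≡ count Q?
count-permute P? Q? π P⇔Q = trans
  (sum-cong-≗ λ i → cong (λ b → if b then 1 else 0) (does-⇔ (P⇔Q i) (P? i) (Q? (π ⟨$⟩ʳ i))))
  (sym (sum-permute (λ i → if does (Q? i) then 1 else 0) π))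

-- Walks, shortest walks and decidability of connection.

-- The length is an index, so walks can be compared and searched for by length. The relation is
-- arbitrary because adjacency, `Outside v` and `Inside v u w` all occur in its place.
data Walk (E : Rel A 0ℓ) : ℕ → A → A → Set where
  []  : ∀ {a} → Walk E zero a a
  _∷_ : ∀ {d a b c} → E a b → Walk E d b c → Walk E (suc d) a c

infixr 5 _∷_

Linked : Rel A 0ℓ → Rel A 0ℓ
Linked E a b = ∃ λ d → Walk E d a b

module _ {E : Rel A 0ℓ} where

  infixr 5 _++_

  _++_ : ∀ {d e a b c} → Walk E d a b → Walk E e b c → Walk E (d + e) a c
  []      ++ w′ = w′
  (e ∷ w) ++ w′ = e ∷ (w ++ w′)

  linked-trans : ∀ {a b c} → Linked E a b → Linked E b c → Linked E a c
  linked-trans (_ , w) (_ , w′) = _ , w ++ w′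

  linked-sym : Symmetric E → Symmetric (Linked E)
  linked-sym E-sym (_ , [])    = _ , []
  linked-sym E-sym (_ , e ∷ w) = linked-trans (linked-sym E-sym (_ , w)) (_ , E-sym e ∷ [])

  -- Past the end of the walk, the value is the final vertex.
  vertex : ∀ {d a b} → Walk E d a b → ℕ → A
  vertex {a = a} _       zero    = a
  vertex {b = b} []      (suc _) = b
  vertex         (e ∷ w) (suc i) = vertex w i

  vertex-end : ∀ {d a b} (w : Walk E d a b) → vertex w d ≡ b
  vertex-end []      = refl
  vertex-end (_ ∷ w) = vertex-end w

  vertex-++ˡ : ∀ {d e a b c} (w : Walk E d a b) (w′ : Walk E e b c) {i} →
    i ≤ d → vertex (w ++ w′) i ≡ vertex w i
  vertex-++ˡ w       w′ {zero}  _   = refl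
  vertex-++ˡ (_ ∷ w) w′ {suc i} i≤d = vertex-++ˡ w w′ (s≤s⁻¹ i≤d)

  vertex-edge : ∀ {d a b} (w : Walk E d a b) {i} → i < d → E (vertex w i) (vertex w (suc i))
  vertex-edge (e ∷ w) {zero}  _   = e
  vertex-edge (e ∷ w) {suc i} i<d = vertex-edge w (s≤s⁻¹ i<d)

  take : ∀ {d a b} (w : Walk E d a b) {i} → i ≤ d → Walk E i a (vertex w i)
  take w       {zero}  _   = []
  take (e ∷ w) {suc i} i≤d = e ∷ take w (s≤s⁻¹ i≤d)

  drop : ∀ {d a b} (w : Walk E d a b) {i} → i ≤ d → Walk E (d ∸ i) (vertex w i) b
  drop w       {zero}  _   = w
  drop (e ∷ w) {suc i} i≤d = drop w (s≤s⁻¹ i≤d)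

  Shortest : ∀ {d a b} → Walk E d a b → Set
  Shortest {d} {a} {b} _ = ∀ {e} → e < d → ¬ Walk E e a b

  module _ {d a b} {w : Walk E d a b} (shortest : Shortest w) where

    -- Following `w` up to `i`, then the shortcut, then `w` from `j` on takes `i + e + (d ∸ j) < d`
    -- steps. Length 0 gives injectivity below, length 1 the absence of chords.
    shortest⇒no-shortcut : ∀ {i j e} → i + e < j → j ≤ d → ¬ Walk E e (vertex w i) (vertex w j)
    shortest⇒no-shortcut {i} {j} {e} i+e<j j≤d w′ = shortest
      (subst ((i + (e + (d ∸ j))) <_) (m+[n∸m]≡n j≤d)
        (subst (_< j + (d ∸ j)) (+-assoc i e (d ∸ j)) (+-monoˡ-< (d ∸ j) i+e<j)))
      (take w (≤-trans (≤-trans (m≤m+n i e) (<⇒≤ i+e<j)) j≤d) ++ w′ ++ drop w j≤d)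

    shortest⇒injective : ∀ {i j} → i ≤ d → j ≤ d → vertex w i ≡ vertex w j → i ≡ j
    shortest⇒injective {i} {j} i≤d j≤d eq with <-cmp i j
    ... | tri≈ _ i≡j _ = i≡j
    ... | tri< i<j _ _ = ⊥-elim (shortest⇒no-shortcut (subst (_< j) (sym (+-identityʳ i)) i<j) j≤d
                           (subst (Walk E 0 _) eq []))
    ... | tri> _ _ j<i = ⊥-elim (shortest⇒no-shortcut (subst (_< i) (sym (+-identityʳ j)) j<i) i≤d
                           (subst (Walk E 0 _) (sym eq) []))

    shortest⇒chordless : ∀ {i j} → j ≤ d → i < j → E (vertex w i) (vertex w j) → j ≡ suc i
    shortest⇒chordless {i} {j} j≤d i<j e with m≤n⇒m<n∨m≡n i<j
    ... | inj₂ si≡j = sym si≡j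
    ... | inj₁ si<j = ⊥-elim (shortest⇒no-shortcut (subst (_< j) (sym (+-comm i 1)) si<j) j≤d (e ∷ []))

walk-map : ∀ {B : Set} {E : Rel A 0ℓ} {F : Rel B 0ℓ} (f : A → B) →
  (∀ {a b} → E a b → F (f a) (f b)) → ∀ {d a b} → Walk E d a b → Walk F d (f a) (f b)
walk-map f E⇒F []      = []
walk-map f E⇒F (e ∷ w) = E⇒F e ∷ walk-map f E⇒F w

vertex-map : ∀ {B : Set} {E : Rel A 0ℓ} {F : Rel B 0ℓ} (f : A → B)
  (E⇒F : ∀ {a b} → E a b → F (f a) (f b)) {d a b} (w : Walk E d a b) i →
  vertex (walk-map {E = E} {F} f E⇒F w) i ≡ f (vertex w i)
vertex-map f E⇒F w       zero    = refl
vertex-map f E⇒F []      (suc i) = refl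
vertex-map {F = F} f E⇒F (e ∷ w) (suc i) = vertex-map {F = F} f E⇒F w i

module _ {E : Rel (Fin sz) 0ℓ} (E? : Decidable E) where

  walk? : ∀ d → Decidable (Walk E d)
  walk? zero    a b = map′ (λ { refl → [] }) (λ { [] → refl }) (a ≟ b)
  walk? (suc d) a b = map′ (λ { (_ , e , w) → e ∷ w }) (λ { (e ∷ w) → _ , e , w })
    (any? λ c → E? a c ×-dec walk? d c b)

  shorten : ∀ {a b} → Linked E a b → ∃ λ d → Σ (Walk E d a b) Shortest
  shorten {a} {b} (d , w) = <-rec (λ d → Walk E d a b → ∃ λ d′ → Σ (Walk E d′ a b) Shortest) go d w
    where
    go : ∀ d → (∀ {e} → e < d → Walk E e a b → ∃ λ d′ → Σ (Walk E d′ a b) Shortest) →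
      Walk E d a b → ∃ λ d′ → Σ (Walk E d′ a b) Shortest
    go d rec w with anyUpTo? (λ e → walk? e a b) d
    ... | yes (e , e<d , w′) = rec e<d w′
    ... | no none            = d , w , λ e<d w′ → none (_ , e<d , w′)

  -- Pigeonhole on the `d + 1` distinct vertices. Only lengths below `sz` then have to be searched
  -- to decide `Linked`.
  shortest⇒< : ∀ {d a b} {w : Walk E d a b} → Shortest w → d < sz
  shortest⇒< {w = w} shortest = injective⇒≤ {f = λ i → vertex w (toℕ i)} λ {i} {j} eq →
    toℕ-injective (shortest⇒injective {w = w} shortest (s≤s⁻¹ (toℕ<n i)) (s≤s⁻¹ (toℕ<n j)) eq)

  linked? : Decidable (Linked E)
  linked? a b = map′ (λ { (d , _ , w) → d , w })
    (λ l → let d , w , shortest = shorten l in d , shortest⇒< {w = w} shortest , w)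
    (anyUpTo? (λ d → walk? d a b) sz)

-- Induced subgraphs and chordless closed walks.

inject₁²≢suc² : (i : Fin sz) → inject₁ (inject₁ i) ≢ suc (suc i)
inject₁²≢suc² i eq = <⇒≢ (m<n⇒m<1+n (n<1+n (toℕ i)))
  (trans (sym (trans (toℕ-inject₁ (inject₁ i)) (toℕ-inject₁ i))) (cong toℕ eq))

adj? : (G : Graph) → Decidable (Adj G)
adj? G u v = adj G u v Bool.≟ true

module _ {G : Graph} where

  seqEdge-sym : ∀ {ℓ} (x : Fin (suc ℓ) → V G) → Symmetric (SeqEdge {G} ℓ x)
  seqEdge-sym x (i , inj₁ e) = i , inj₂ e
  seqEdge-sym x (i , inj₂ e) = i , inj₁ e

  adj-symmetric : Symmetric (Adj G)
  adj-symmetric {u} {v} = trans (adj-sym G v u)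

  adj⇒≢ : ∀ {u v} → Adj G u v → u ≢ v
  adj⇒≢ {u} a refl with () ← trans (sym (adj-irrefl G u)) a

  seqEdge⇒adj : ∀ {ℓ} (x : Fin (suc ℓ) → V G) →
    (∀ i → Adj G (x (inject₁ i)) (x (suc i))) →
    ∀ {u v} → SeqEdge {G} ℓ x u v → Adj G u v
  seqEdge⇒adj x x-edges (i , inj₁ (refl , refl)) = x-edges i
  seqEdge⇒adj x x-edges (i , inj₂ (refl , refl)) = adj-symmetric (x-edges i)

  inducedCycle-edge : ∀ {m} (C : Cycle G m) → InducedCycle C → ∀ {u v} →
    SeqVertex {G} m (cvtx C) u → SeqVertex {G} m (cvtx C) v →
    Adj G u v → SeqEdge {G} m (cvtx C) u v
  inducedCycle-edge C ind (i , refl) (j , refl) = ind i j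

  -- Path and cycle are both induced, so on the vertices of the path each has exactly the edges of
  -- `G`.
  vertices⊆⇒inducedSubgraph : ∀ {ℓ m} (P : Path G ℓ) (C : Cycle G m) →
    InducedPath P → InducedCycle C →
    (∀ i → SeqVertex {G} m (cvtx C) (vtx P i)) → InducedSubgraphOf P C
  vertices⊆⇒inducedSubgraph P C indP indC P⊆C = P⊆C , λ i j →
    (λ e → inducedCycle-edge C indC (P⊆C i) (P⊆C j) (seqEdge⇒adj (vtx P) (edges P) e)) ,
    (λ e → indP i j (seqEdge⇒adj (cvtx C) (cedges C) e))

  -- Positions cover one turn, `0, …, m - 1`; the second alternative in `chords` is the closing edge
  -- between the last position and the first.
  record Chordless {m v} (w : Walk (Adj G) m v v) : Set where
    field
      3≤length  : 3 ≤ m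
      injective : ∀ {i j} → i < m → j < m → vertex w i ≡ vertex w j → i ≡ j
      chords    : ∀ {i j} → i < j → j < m → Adj G (vertex w i) (vertex w j) →
                  j ≡ suc i ⊎ (i ≡ 0 × suc j ≡ m)

  module _ {m v} {w : Walk (Adj G) m v v} (cl : Chordless w) where

    open Chordless cl

    chordless⇒cycle : Cycle G m
    chordless⇒cycle = record
      { long      = 3≤length
      ; cvtx      = λ i → vertex w (toℕ i)
      ; closed    = trans (cong (vertex w) (toℕ-fromℕ m)) (vertex-end w)
      ; cdistinct = λ i j eq → toℕ-injective (injective (toℕ<n i) (toℕ<n j)
          (subst₂ (λ a b → vertex w a ≡ vertex w b) (toℕ-inject₁ i) (toℕ-inject₁ j) eq))
      ; cedges    = λ i → subst (λ a → Adj G (vertex w a) (vertex w (suc (toℕ i))))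
          (sym (toℕ-inject₁ i)) (vertex-edge w (toℕ<n i))
      }

    private
      c = cvtx chordless⇒cycle

    chordless-edge : ∀ {i} → i < m → SeqEdge {G} m c (vertex w i) (vertex w (suc i))
    chordless-edge i<m = fromℕ< i<m , inj₁
      ( cong (vertex w) (sym (trans (toℕ-inject₁ (fromℕ< i<m)) (toℕ-fromℕ< i<m)))
      , cong (vertex w ∘ suc) (sym (toℕ-fromℕ< i<m)))

    chordless-vertex : ∀ {i} → i < m → SeqVertex {G} m c (vertex w i)
    chordless-vertex i<m = fromℕ< (m<n⇒m<1+n i<m) , cong (vertex w) (toℕ-fromℕ< (m<n⇒m<1+n i<m))

    chordless⇒inducedCycle : InducedCycle chordless⇒cycle
    chordless⇒inducedCycle i j with representative i | representative j
      where
      -- Position `m` repeats position 0 and is replaced by it, since `chords` speaks only of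
      -- positions below `m`.
      representative : ∀ i → ∃ λ a → a < m × vertex w a ≡ c i
      representative i with m≤n⇒m<n∨m≡n (s≤s⁻¹ (toℕ<n i))
      ... | inj₁ i<m = toℕ i , i<m , refl
      ... | inj₂ i≡m = 0 , ≤-trans (s≤s z≤n) 3≤length ,
                       sym (trans (cong (vertex w) i≡m) (vertex-end w))
    ... | a , a<m , eqa | b , b<m , eqb =
      subst₂ (λ x y → Adj G x y → SeqEdge {G} m c x y) eqa eqb go
      where
      forward : ∀ {a b} → a < b → b < m →
        Adj G (vertex w a) (vertex w b) → SeqEdge {G} m c (vertex w a) (vertex w b)
      forward a<b b<m ab with chords a<b b<m ab
      ... | inj₁ refl          = chordless-edge (<⇒≤ b<m)
      ... | inj₂ (refl , refl) = seqEdge-sym c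
        (subst (SeqEdge {G} m c _) (vertex-end w) (chordless-edge b<m))
      go : Adj G (vertex w a) (vertex w b) → SeqEdge {G} m c (vertex w a) (vertex w b)
      go ab with <-cmp a b
      ... | tri< a<b _ _  = forward a<b b<m ab
      ... | tri≈ _ refl _ = contradiction refl (adj⇒≢ ab)
      ... | tri> _ _ b<a  = seqEdge-sym c (forward b<a a<m (adj-symmetric ab))

  -- Induced cycles through a vertex and two of its neighbours.

  -- The closed neighbourhood `N[v]`.
  data Nb (v : V G) : V G → Set where
    self : Nb v v
    nbr  : ∀ {y} → Adj G v y → Nb v y

  nb? : Decidable Nb
  nb? v y = map′ (λ { (inj₁ refl) → self ; (inj₂ a) → nbr a })
    (λ { self → inj₁ refl ; (nbr a) → inj₂ a }) (v ≟ y ⊎-dec adj? G v y)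

  -- The edges of `G - N[v]`. The classes of `Linked (Outside v)` are its components, together with
  -- a singleton for each vertex of `N[v]`.
  Outside : V G → Rel (V G) 0ℓ
  Outside v a b = Adj G a b × ¬ Nb v a × ¬ Nb v b

  outside? : ∀ v → Decidable (Outside v)
  outside? v a b = adj? G a b ×-dec ¬? (nb? v a) ×-dec ¬? (nb? v b)

  outside-sym : ∀ {v} → Symmetric (Outside v)
  outside-sym (ab , a∉ , b∉) = adj-symmetric ab , b∉ , a∉

  data Corridor (v u w : V G) : V G → Set where
    left  : Corridor v u w u
    right : Corridor v u w w
    far   : ∀ {a} → ¬ Nb v a → Corridor v u w a

  corridor? : ∀ v u w a → Dec (Corridor v u w a)
  corridor? v u w a = map′
    (λ { (inj₁ refl) → left ; (inj₂ (inj₁ refl)) → right ; (inj₂ (inj₂ a∉)) → far a∉ })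
    (λ { left → inj₁ refl ; right → inj₂ (inj₁ refl) ; (far a∉) → inj₂ (inj₂ a∉) })
    (a ≟ u ⊎-dec a ≟ w ⊎-dec ¬? (nb? v a))

  Inside : V G → V G → V G → Rel (V G) 0ℓ
  Inside v u w a b = Adj G a b × Corridor v u w a × Corridor v u w b

  inside? : ∀ v u w → Decidable (Inside v u w)
  inside? v u w a b = adj? G a b ×-dec corridor? v u w a ×-dec corridor? v u w b

  InducedCycleThrough : V G → V G → V G → Set
  InducedCycleThrough u v w = ∃ λ m → Σ (Cycle G m) λ C → InducedCycle C ×
    SeqVertex {G} m (cvtx C) u × SeqVertex {G} m (cvtx C) v × SeqVertex {G} m (cvtx C) w

  -- Closing a shortest corridor walk through `v` works: minimality excludes chords within the walk,
  -- and the corridor meets `N[v]` only in `u` and `w`, which excludes chords at `v`.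
  corridor⇒inducedCycle : ∀ {v u w} → Adj G v u → Adj G v w → u ≢ w →
    Linked (Inside v u w) u w → InducedCycleThrough u v w
  corridor⇒inducedCycle {v} {u} {w} vu vw u≢w linked with shorten (inside? v u w) linked
  ... | zero , [] , _ = contradiction refl u≢w
  ... | d@(suc _) , p , shortest = _ , chordless⇒cycle cl , chordless⇒inducedCycle cl
      -- On `cycleWalk`, `v` has position 0 and `p` is shifted by one, so `u` has position 1 and `w`
      -- position `suc d`.
      , on-cycle (s<s (m≤n+m 1 d)) (at z≤n)
      , on-cycle (s≤s z≤n) refl
      , on-cycle (s<s (m<m+n d (s≤s z≤n))) (trans (at ≤-refl) (vertex-end p))
    where
    p′ : Walk (Adj G) d u w
    p′ = walk-map (λ a → a) proj₁ p

    cycleWalk : Walk (Adj G) (suc (d + 1)) v v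
    cycleWalk = vu ∷ p′ ++ adj-symmetric vw ∷ []

    at : ∀ {i} → i ≤ d → vertex cycleWalk (suc i) ≡ vertex p i
    at {i} i≤d = trans (vertex-++ˡ p′ _ i≤d) (vertex-map {F = Adj G} (λ a → a) proj₁ p i)

    bound : ∀ {i} → suc i < suc (d + 1) → i ≤ d
    bound {i} i<m = s≤s⁻¹ (subst (i <_) (+-comm d 1) (s≤s⁻¹ i<m))

    in-corridor : ∀ {i} → i ≤ d → Corridor v u w (vertex p i)
    in-corridor i≤d with m≤n⇒m<n∨m≡n i≤d
    ... | inj₁ i<d  = proj₁ (proj₂ (vertex-edge p i<d))
    ... | inj₂ refl = subst (Corridor v u w) (sym (vertex-end p)) right

    v∉corridor : ¬ Corridor v u w v
    v∉corridor left     = adj⇒≢ vu refl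
    v∉corridor right    = adj⇒≢ vw refl
    v∉corridor (far v∉) = v∉ self

    inj : ∀ {i j} → i < suc (d + 1) → j < suc (d + 1) →
      vertex cycleWalk i ≡ vertex cycleWalk j → i ≡ j
    inj {zero}  {zero}  _   _   _  = refl
    inj {zero}  {suc j} _   j<m eq = contradiction
      (subst (Corridor v u w) (sym (trans eq (at (bound j<m)))) (in-corridor (bound j<m))) v∉corridor
    inj {suc i} {zero}  i<m _   eq = contradiction
      (subst (Corridor v u w) (trans (sym (at (bound i<m))) eq) (in-corridor (bound i<m))) v∉corridor
    inj {suc i} {suc j} i<m j<m eq = cong suc
      (shortest⇒injective {w = p} shortest (bound i<m) (bound j<m)
        (trans (sym (at (bound i<m))) (trans eq (at (bound j<m)))))

    neighbour-end : ∀ {a j} → j ≤ d → vertex p j ≡ a → Adj G v a → Corridor v u w a → j ≡ 0 ⊎ j ≡ d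
    neighbour-end j≤d eq va left     = inj₁ (shortest⇒injective {w = p} shortest j≤d z≤n eq)
    neighbour-end j≤d eq va right    = inj₂ (shortest⇒injective {w = p} shortest j≤d ≤-refl
                                          (trans eq (sym (vertex-end p))))
    neighbour-end j≤d eq va (far a∉) = contradiction (nbr va) a∉

    ch : ∀ {i j} → i < j → j < suc (d + 1) → Adj G (vertex cycleWalk i) (vertex cycleWalk j) →
      j ≡ suc i ⊎ (i ≡ 0 × suc j ≡ suc (d + 1))
    ch {zero} {suc j} _ j<m a with
      neighbour-end (bound j<m) refl (subst (Adj G v) (at (bound j<m)) a) (in-corridor (bound j<m))
    ... | inj₁ refl = inj₁ refl
    ... | inj₂ refl = inj₂ (refl , cong suc (+-comm 1 d))
    ch {suc i} {suc j} i<j j<m a = inj₁ (cong suc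
      (shortest⇒chordless {w = p} shortest (bound j<m) (s≤s⁻¹ i<j)
        (subst₂ (Adj G) (at i≤d) (at (bound j<m)) a , in-corridor i≤d , in-corridor (bound j<m))))
      where
      i≤d = ≤-trans (<⇒≤ (s≤s⁻¹ i<j)) (bound j<m)

    cl : Chordless cycleWalk
    cl = record
      { 3≤length  = s≤s (subst (2 ≤_) (+-comm 1 d) (s≤s (s≤s z≤n)))
      ; injective = inj
      ; chords    = ch
      }

    on-cycle : ∀ {i a} → i < suc (d + 1) → vertex cycleWalk i ≡ a →
      SeqVertex {G} _ (cvtx (chordless⇒cycle cl)) a
    on-cycle i<m refl = chordless-vertex cl i<m

  -- Degrees and component sizes under vertex-transitivity.

  IsAutomorphism-flip : ∀ σ → IsAutomorphism G σ → IsAutomorphism G (flip σ)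
  IsAutomorphism-flip σ aut x y = trans (sym (aut _ _))
    (subst₂ (λ a b → adj G a b ≡ adj G x y) (sym (inverseʳ σ)) (sym (inverseʳ σ)) refl)

  nb-map : ∀ σ → IsAutomorphism G σ → ∀ {v y} → Nb v y → Nb (σ ⟨$⟩ʳ v) (σ ⟨$⟩ʳ y)
  nb-map σ aut self    = self
  nb-map σ aut (nbr a) = nbr (trans (aut _ _) a)

  nb-reflect : ∀ σ → IsAutomorphism G σ → ∀ {v y} → Nb (σ ⟨$⟩ʳ v) (σ ⟨$⟩ʳ y) → Nb v y
  nb-reflect σ aut = subst₂ Nb (inverseˡ σ) (inverseˡ σ) ∘ nb-map (flip σ) (IsAutomorphism-flip σ aut)

  linked-map : ∀ σ → IsAutomorphism G σ → ∀ {v y z} →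
    Linked (Outside v) y z → Linked (Outside (σ ⟨$⟩ʳ v)) (σ ⟨$⟩ʳ y) (σ ⟨$⟩ʳ z)
  linked-map σ aut (d , w) = d , walk-map (σ ⟨$⟩ʳ_)
    (λ { (ab , a∉ , b∉) → trans (aut _ _) ab , a∉ ∘ nb-reflect σ aut , b∉ ∘ nb-reflect σ aut }) w

  linked-reflect : ∀ σ → IsAutomorphism G σ → ∀ {v y z} →
    Linked (Outside (σ ⟨$⟩ʳ v)) (σ ⟨$⟩ʳ y) (σ ⟨$⟩ʳ z) → Linked (Outside v) y z
  linked-reflect σ aut {v} l =
    subst (λ v → Linked (Outside v) _ _) (inverseˡ σ)
      (subst₂ (Linked (Outside _)) (inverseˡ σ) (inverseˡ σ)
        (linked-map (flip σ) (IsAutomorphism-flip σ aut) l))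

  -- One more than the usual degree, since `v` itself is counted.
  degree : V G → ℕ
  degree v = count (nb? v)

  -- For `y` in `N[v]` the value is 1: only the empty walk starts there.
  componentSize : V G → V G → ℕ
  componentSize v y = count (linked? (outside? v) y)

  large? : ∀ s v → Unary.Decidable (λ z → s < componentSize v z)
  large? s v z = s <? componentSize v z

  degree-invariant : ∀ σ → IsAutomorphism G σ → ∀ v → degree v ≡ degree (σ ⟨$⟩ʳ v)
  degree-invariant σ aut v = count-permute (nb? v) (nb? (σ ⟨$⟩ʳ v)) σ
    λ _ → mk⇔ (nb-map σ aut) (nb-reflect σ aut)

  componentSize-invariant : ∀ σ → IsAutomorphism G σ → ∀ v y →
    componentSize v y ≡ componentSize (σ ⟨$⟩ʳ v) (σ ⟨$⟩ʳ y)
  componentSize-invariant σ aut v y = count-permute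
    (linked? (outside? v) y) (linked? (outside? (σ ⟨$⟩ʳ v)) (σ ⟨$⟩ʳ y)) σ
    λ _ → mk⇔ (linked-map σ aut) (linked-reflect σ aut)

  large-invariant : ∀ σ → IsAutomorphism G σ → ∀ s v →
    count (large? s v) ≡ count (large? s (σ ⟨$⟩ʳ v))
  large-invariant σ aut s v = count-permute (large? s v) (large? s (σ ⟨$⟩ʳ v)) σ
    λ z → mk⇔ (subst (s <_) (componentSize-invariant σ aut v z))
              (subst (s <_) (sym (componentSize-invariant σ aut v z)))

  -- A vertex of the component of `z` in `G - N[v]` that was `x` or adjacent to `x` would link `z`
  -- to `x` there. So the whole component avoids `N[x]`, and its walks survive in `G - N[x]`.
  outside-transfer : ∀ {v x z b} → ¬ Nb v x → ¬ Linked (Outside v) z x →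
    Linked (Outside v) z b → Linked (Outside x) z b
  outside-transfer {v} {x} x∉ z≁x (_ , w) = _ , go z≁x w
    where
    avoids : ∀ {a} → ¬ Nb v a → ¬ Linked (Outside v) a x → ¬ Nb x a
    avoids a∉ a≁x self     = a≁x (_ , [])
    avoids a∉ a≁x (nbr xa) = a≁x (_ , (adj-symmetric xa , a∉ , x∉) ∷ [])
    go : ∀ {d z b} → ¬ Linked (Outside v) z x → Walk (Outside v) d z b → Walk (Outside x) d z b
    go z≁x [] = []
    go z≁x (e@(ab , a∉ , b∉) ∷ w) = (ab , avoids a∉ z≁x , avoids b∉ b≁x) ∷ go b≁x w
      where
      b≁x = λ l → z≁x (linked-trans (_ , e ∷ []) l)

  module _ (vt : VertexTransitive G) where

    -- Otherwise `N[u]` lies in `N[v]` and misses `w`, so `u` has smaller degree than `v`.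
    neighbour-outside : ∀ {v u w} → Adj G v u → Adj G v w → u ≢ w → ¬ Adj G u w →
      ∃ λ y → Adj G u y × ¬ Nb v y
    neighbour-outside {v} {u} {w} vu vw u≢w u≁w with any? (λ y → nb? u y ×-dec ¬? (nb? v y))
    ... | yes (_ , self   , y∉) = contradiction (nbr vu) y∉
    ... | yes (y , nbr uy , y∉) = y , uy , y∉
    ... | no none = let σ , aut , σu≡v = vt u v in contradiction
      (trans (degree-invariant σ aut u) (cong degree σu≡v))
      (<⇒≢ (count-mono-< (nb? u) (nb? v)
        (λ y uy → decidable-stable (nb? v y) λ y∉ → none (y , uy , y∉))
        w (λ { self → u≢w refl ; (nbr uw) → u≁w uw }) (nbr vw)))

    -- If x and y lay in different components of G - N[v], then moving the base point from v to
    -- x would keep every component larger than that of y and enlarge that of y by u.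
    no-separation : ∀ {v u x y} → Adj G v u → Adj G u y → ¬ Nb v y → ¬ Nb v x → ¬ Adj G u x →
      ¬ Linked (Outside v) y x → ¬ componentSize v x ≤ componentSize v y
    no-separation {v} {u} {x} {y} vu uy y∉ x∉ u≁x y≁x x≤y =
      let σ , aut , σv≡x = vt v x in contradiction
        (trans (large-invariant σ aut s v) (cong (λ x → count (large? s x)) σv≡x))
        -- `y` makes the inclusion strict: its component has exactly `s` vertices at `v` and more
        -- than `s` at `x`.
        (<⇒≢ (count-mono-< (large? s v) (large? s x) still-large y (<-irrefl refl) grows))
      where
      s = componentSize v y

      still-large : ∀ z → s < componentSize v z → s < componentSize x z
      still-large z s<z = <-≤-trans s<z
        (count-mono (linked? (outside? v) z) (linked? (outside? x) z)
          λ _ → outside-transfer x∉ z≁x)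
        where
        -- The component of `x` has at most `s` vertices, so one with more cannot contain `x`.
        z≁x : ¬ Linked (Outside v) z x
        z≁x zx = <⇒≱ s<z (≤-trans
          (count-mono (linked? (outside? v) z) (linked? (outside? v) x)
            λ _ → linked-trans (linked-sym outside-sym zx)) x≤y)

      u≁y-outside : ¬ Linked (Outside v) y u
      u≁y-outside l with linked-sym outside-sym l
      ... | _ , []                 = y∉ (nbr vu)
      ... | _ , (_ , u∉ , _) ∷ _   = u∉ (nbr vu)

      u∉ : ¬ Nb x u
      u∉ self     = x∉ (nbr vu)
      u∉ (nbr xu) = u≁x (adj-symmetric xu)

      y∉x : ¬ Nb x y
      y∉x self     = y≁x (_ , [])
      y∉x (nbr xy) = y≁x (_ , (adj-symmetric xy , y∉ , x∉) ∷ [])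

      -- The vertex gained is `u`: it was removed with `N[v]`, but lies outside `N[x]` and is
      -- adjacent to `y`.
      grows : s < componentSize x y
      grows = count-mono-< (linked? (outside? v) y) (linked? (outside? x) y)
        (λ _ → outside-transfer x∉ y≁x) u u≁y-outside
        (_ , (adj-symmetric uy , y∉x , u∉) ∷ [])

    linked-corridor : ∀ {v u w} → Adj G v u → Adj G v w → u ≢ w → Linked (Inside v u w) u w
    linked-corridor {v} {u} {w} vu vw u≢w with linked? (inside? v u w) u w
    ... | yes l  = l
    ... | no u≁w = contradiction (≤-total (componentSize v x) (componentSize v y)) λ where
        -- The pairs `u`, `y` and `w`, `x` exchange roles according to which component is the
        -- larger.
        (inj₁ x≤y) → no-separation vu uy y∉ x∉ (λ ux → separated ux x∉ (_ , []) x∉ wx)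
          (λ l → separated uy y∉ l x∉ wx) x≤y
        (inj₂ y≤x) → no-separation vw wx x∉ y∉ (λ wy → separated uy y∉ (_ , []) y∉ wy)
          (λ l → separated uy y∉ (linked-sym outside-sym l) x∉ wx) y≤x
      where
      -- Otherwise `u, a, …, b, w` would be a walk in the corridor. The empty walk, with `a` and `b`
      -- equal, rules out common neighbours outside `N[v]`.
      separated : ∀ {a b} → Adj G u a → ¬ Nb v a → Linked (Outside v) a b → ¬ Nb v b → ¬ Adj G w b
      separated ua a∉ (_ , l) b∉ wb = u≁w (_ , (ua , left , far a∉) ∷
        walk-map (λ a → a) (λ { (ab , a∉ , b∉) → ab , far a∉ , far b∉ }) l
        ++ (adj-symmetric wb , far b∉ , right) ∷ [])

      outside-u = neighbour-outside vu vw u≢w λ uw → u≁w (_ , (uw , left , right) ∷ [])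
      outside-w = neighbour-outside vw vu (u≢w ∘ sym)
        λ wu → u≁w (_ , (adj-symmetric wu , left , right) ∷ [])
      y = proj₁ outside-u
      uy = proj₁ (proj₂ outside-u)
      y∉ = proj₂ (proj₂ outside-u)
      x = proj₁ outside-w
      wx = proj₁ (proj₂ outside-w)
      x∉ = proj₂ (proj₂ outside-w)

    neighbours⇒inducedCycle : ∀ {v u w} → Adj G v u → Adj G v w → u ≢ w → InducedCycleThrough u v w
    neighbours⇒inducedCycle vu vw u≢w = corridor⇒inducedCycle vu vw u≢w (linked-corridor vu vw u≢w)

  -- Closing induced paths of length at most 2.

  -- If every vertex were `a` or `b`, testing equality with `a` would inject `V G` into `Fin 2`.
  third-vertex : 3 ≤ n G → ∀ a b → ∃ λ z → z ≢ a × z ≢ b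
  third-vertex 3≤n a b with any? (λ z → ¬? (z ≟ a) ×-dec ¬? (z ≟ b))
  ... | yes found = found
  ... | no none   = contradiction (injective⇒≤ inj) (<⇒≱ 3≤n)
    where
    is-a : V G → Fin 2
    is-a z = if does (z ≟ a) then zero else suc zero
    b-otherwise : ∀ {z} → z ≢ a → z ≡ b
    b-otherwise {z} z≢a = decidable-stable (z ≟ b) λ z≢b → none (z , z≢a , z≢b)
    inj : ∀ {y z} → is-a y ≡ is-a z → y ≡ z
    inj {y} {z} eq with y ≟ a | z ≟ a
    inj eq | yes y≡a | yes z≡a = trans y≡a (sym z≡a)
    inj () | yes _   | no _
    inj () | no _    | yes _
    inj eq | no y≢a  | no z≢a  = trans (b-otherwise y≢a) (sym (b-otherwise z≢a))

  -- Taken from the first step of the walk that leaves `{a, b}`. It extends an edge `ab` to three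
  -- vertices, one adjacent to the other two.
  exit : ∀ {a b z} → z ≢ a → z ≢ b → ∀ {s} → s ≡ a ⊎ s ≡ b → Reach G s z →
    (∃ λ y → Adj G a y × y ≢ b) ⊎ (∃ λ y → Adj G b y × y ≢ a)
  exit z≢a z≢b (inj₁ refl) here = contradiction refl z≢a
  exit z≢a z≢b (inj₂ refl) here = contradiction refl z≢b
  exit {a} {b} z≢a z≢b s (step {w = y} sy yz) with y ≟ a | y ≟ b
  ... | yes y≡a | _       = exit z≢a z≢b (inj₁ y≡a) yz
  ... | no _    | yes y≡b = exit z≢a z≢b (inj₂ y≡b) yz
  ... | no y≢a  | no y≢b with s
  ... | inj₁ refl = inj₁ (y , sy , y≢b)
  ... | inj₂ refl = inj₂ (y , sy , y≢a)

  through⇒closes : ∀ {ℓ} (P : Path G ℓ) → InducedPath P → ∀ {u v w} → InducedCycleThrough u v w →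
    (∀ i → vtx P i ≡ u ⊎ vtx P i ≡ v ⊎ vtx P i ≡ w) → ClosesToInducedCycle P
  through⇒closes P indP {u} {v} {w} (m , C , indC , u∈ , v∈ , w∈) P⊆ =
    m , C , indC , vertices⊆⇒inducedSubgraph P C indP indC λ i → on (P⊆ i)
    where
    on : ∀ {x} → x ≡ u ⊎ x ≡ v ⊎ x ≡ w → SeqVertex {G} m (cvtx C) x
    on (inj₁ refl)        = u∈
    on (inj₂ (inj₁ refl)) = v∈
    on (inj₂ (inj₂ refl)) = w∈

  module _ (connected : Connected G) (vt : VertexTransitive G) (3≤n : 3 ≤ n G) where

    edge⇒inducedCycle : ∀ {a b} → Adj G a b → ∃ (InducedCycleThrough a b)
    edge⇒inducedCycle {a} {b} ab
      with z , z≢a , z≢b ← third-vertex 3≤n a b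
      with exit z≢a z≢b (inj₁ refl) (connected a z)
    ... | inj₁ (y , ay , y≢b) with m , C , ind , b∈ , a∈ , y∈ ← neighbours⇒inducedCycle vt ab ay (y≢b ∘ sym)
      = y , m , C , ind , a∈ , b∈ , y∈
    ... | inj₂ (y , by , y≢a) = y , neighbours⇒inducedCycle vt (adj-symmetric ab) by (y≢a ∘ sym)

    neighbour : ∀ a → ∃ (Adj G a)
    neighbour a with z , z≢a , _ ← third-vertex 3≤n a a with connected a z
    ... | here      = contradiction refl z≢a
    ... | step ay _ = _ , ay

    short-path-closes : ∀ ℓ → ℓ ≤ 2 → (P : Path G ℓ) → InducedPath P → ClosesToInducedCycle P
    short-path-closes 0 _ P indP =
      through⇒closes P indP (proj₂ (edge⇒inducedCycle (proj₂ (neighbour (vtx P zero)))))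
        λ { zero → inj₁ refl }
    short-path-closes 1 _ P indP = through⇒closes P indP (proj₂ (edge⇒inducedCycle (edges P zero)))
      λ { zero → inj₁ refl ; (suc zero) → inj₂ (inj₁ refl) }
    short-path-closes 2 _ P indP = through⇒closes P indP
      (neighbours⇒inducedCycle vt (adj-symmetric (edges P zero)) (edges P (suc zero))
        (λ eq → contradiction (distinct P zero (suc (suc zero)) eq) λ ()))
      λ { zero → inj₁ refl ; (suc zero) → inj₂ (inj₁ refl) ; (suc (suc zero)) → inj₂ (inj₂ refl) }
    short-path-closes (suc (suc (suc _))) (s≤s (s≤s ()))

  -- Vertex degrees on a cycle and trapped ends.

  cycle-repeat : ∀ {m} (C : Cycle G m) {a b} → cvtx C a ≡ cvtx C b →
    a ≡ b ⊎ (a ≡ zero × b ≡ fromℕ m) ⊎ (b ≡ zero × a ≡ fromℕ m)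
  cycle-repeat {zero}  C with () ← long C
  cycle-repeat {suc m} C {a} {b} eq with view a | view b
  ... | ‵fromℕ     | ‵fromℕ     = inj₁ refl
  ... | ‵fromℕ     | ‵inject₁ j = inj₂ (inj₂
    (cong inject₁ (cdistinct C j zero (trans (sym eq) (closed C))) , refl))
  ... | ‵inject₁ i | ‵fromℕ     = inj₂ (inj₁
    (cong inject₁ (cdistinct C i zero (trans eq (closed C))) , refl))
  ... | ‵inject₁ i | ‵inject₁ j = inj₁ (cong inject₁ (cdistinct C i j eq))

  module _ {m} (C : Cycle G m) where

    private
      EdgeC = SeqEdge {G} m (cvtx C)

    successor-unique : ∀ {i j} → cvtx C (inject₁ i) ≡ cvtx C (inject₁ j) → cvtx C (suc i) ≡ cvtx C (suc j)
    successor-unique {i} {j} eq = cong (cvtx C ∘ suc) (cdistinct C i j eq)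

    -- Positions `1, …, m` also meet each vertex once, as the repeated position 0 is left out.
    predecessor-unique : ∀ {i j} → cvtx C (suc i) ≡ cvtx C (suc j) →
      cvtx C (inject₁ i) ≡ cvtx C (inject₁ j)
    predecessor-unique eq with cycle-repeat C eq
    ... | inj₁ refl             = refl
    ... | inj₂ (inj₁ (() , _))
    ... | inj₂ (inj₂ (() , _))

    -- Each edge either leaves or enters `x` along the cycle; among three, two have the same
    -- direction and hence the same other end.
    cycle-degree≤2 : ∀ {x y₁ y₂ y₃} → EdgeC x y₁ → EdgeC x y₂ → EdgeC x y₃ →
      y₁ ≡ y₂ ⊎ y₁ ≡ y₃ ⊎ y₂ ≡ y₃
    cycle-degree≤2 e₁ e₂ e₃ with side e₁ | side e₂ | side e₃
      where
      side : ∀ {x y} → EdgeC x y →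
        (∃ λ i → x ≡ cvtx C (inject₁ i) × y ≡ cvtx C (suc i)) ⊎
        (∃ λ i → x ≡ cvtx C (suc i) × y ≡ cvtx C (inject₁ i))
      side (i , inj₁ (p , q)) = inj₁ (i , p , q)
      side (i , inj₂ (p , q)) = inj₂ (i , q , p)
    ... | inj₁ (_ , p , refl) | inj₁ (_ , q , refl) | _ = inj₁ (successor-unique (trans (sym p) q))
    ... | inj₂ (_ , p , refl) | inj₂ (_ , q , refl) | _ = inj₁ (predecessor-unique (trans (sym p) q))
    ... | inj₁ (_ , p , refl) | inj₂ _ | inj₁ (_ , q , refl) = inj₂ (inj₁ (successor-unique (trans (sym p) q)))
    ... | inj₂ (_ , p , refl) | inj₁ _ | inj₂ (_ , q , refl) = inj₂ (inj₁ (predecessor-unique (trans (sym p) q)))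
    ... | inj₂ _ | inj₁ (_ , p , refl) | inj₁ (_ , q , refl) = inj₂ (inj₂ (successor-unique (trans (sym p) q)))
    ... | inj₁ _ | inj₂ (_ , p , refl) | inj₂ (_ , q , refl) = inj₂ (inj₂ (predecessor-unique (trans (sym p) q)))

  TwoNeighbours : ∀ {m} → Cycle G m → V G → Set
  TwoNeighbours {m} C x = ∃ λ y → ∃ λ z →
    SeqEdge {G} m (cvtx C) x y × SeqEdge {G} m (cvtx C) x z × y ≢ z

  cycle-degree≥2-inject₁ : ∀ {m} (C : Cycle G (3 + m)) i → TwoNeighbours C (cvtx C (inject₁ i))
  cycle-degree≥2-inject₁ C zero =
    _ , _ , (zero , inj₁ (refl , refl)) , (fromℕ _ , inj₂ (refl , sym (closed C))) ,
    λ eq → case cycle-repeat C eq of λ { (inj₁ ()) ; (inj₂ (inj₁ (() , _))) ; (inj₂ (inj₂ (() , _))) }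
  cycle-degree≥2-inject₁ {m} C (suc j) =
    _ , _ , (inject₁ j , inj₂ (refl , refl)) , (suc j , inj₁ (refl , refl)) ,
    λ eq → apart j (cycle-repeat C eq)
    where
    apart : ∀ j → ¬ (inject₁ (inject₁ j) ≡ suc (suc j) ⊎
      (inject₁ (inject₁ j) ≡ zero × suc (suc j) ≡ fromℕ (3 + m)) ⊎
      (suc (suc j) ≡ zero × inject₁ (inject₁ j) ≡ fromℕ (3 + m)))
    apart j    (inj₁ eq)              = inject₁²≢suc² j eq
    -- Positions 0 and 2 would coincide only on a closed walk of length 2.
    apart zero (inj₂ (inj₁ (_ , ())))
    apart _    (inj₂ (inj₂ (() , _)))

  cycle-degree≥2 : ∀ {m} (C : Cycle G m) {x} → SeqVertex {G} m (cvtx C) x → TwoNeighbours C x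
  cycle-degree≥2 {0} C with () ← long C
  cycle-degree≥2 {1} C with s≤s () ← long C
  cycle-degree≥2 {2} C with s≤s (s≤s ()) ← long C
  cycle-degree≥2 {suc (suc (suc m))} C (a , refl) with view a
  ... | ‵fromℕ     = subst (TwoNeighbours C) (sym (closed C)) (cycle-degree≥2-inject₁ C zero)
  ... | ‵inject₁ i = cycle-degree≥2-inject₁ C i

  -- On an induced cycle containing P, the end of P has a neighbour y other than its predecessor
  -- on P; y is adjacent to an interior vertex of P, which already has two neighbours on the cycle.
  trapped-end⇒¬closes : ∀ {ℓ} (P : Path G (suc ℓ)) →
    (∀ y → Adj G (vtx P (fromℕ (suc ℓ))) y →
      y ≡ vtx P (inject₁ (fromℕ ℓ)) ⊎ ∃ λ i → Adj G y (vtx P (suc (inject₁ i)))) →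
    ¬ ClosesToInducedCycle P
  trapped-end⇒¬closes {ℓ} P trapped (m , C , indC , P⊆C , edges⇔)
    with y , z , xy , xz , y≢z ← cycle-degree≥2 C (P⊆C (fromℕ (suc ℓ)))
    = y≢z (trans (predecessor xy) (sym (predecessor xz)))
    where
    EdgeC = SeqEdge {G} m (cvtx C)

    edge-vertex : ∀ {x y} → EdgeC x y → SeqVertex {G} m (cvtx C) y
    edge-vertex (i , inj₁ (_ , eq)) = suc i , sym eq
    edge-vertex (i , inj₂ (eq , _)) = inject₁ i , sym eq

    path-edge : ∀ i → EdgeC (vtx P (inject₁ i)) (vtx P (suc i))
    path-edge i = proj₁ (edges⇔ (inject₁ i) (suc i)) (i , inj₁ (refl , refl))

    -- `P` is induced in `C`, so this cycle edge is a path edge, and the end of `P` lies on only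
    -- one.
    predecessor-on-path : ∀ j → EdgeC (vtx P (fromℕ (suc ℓ))) (vtx P j) →
      vtx P j ≡ vtx P (inject₁ (fromℕ ℓ))
    predecessor-on-path j e with proj₂ (edges⇔ (fromℕ (suc ℓ)) j) e
    ... | i , inj₁ (eq , _)    = contradiction (distinct P _ _ eq) fromℕ≢inject₁
    ... | i , inj₂ (eqj , eq) with refl ← distinct P (fromℕ (suc ℓ)) (suc i) eq = eqj

    predecessor : ∀ {y} → EdgeC (vtx P (fromℕ (suc ℓ))) y → y ≡ vtx P (inject₁ (fromℕ ℓ))
    predecessor {y} e with trapped y (seqEdge⇒adj (cvtx C) (cedges C) e)
    ... | inj₁ eq = eq
    ... | inj₂ (i , a)
      with cycle-degree≤2 C (seqEdge-sym (cvtx C) (inducedCycle-edge C indC (edge-vertex e) (P⊆C (suc (inject₁ i))) a))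
             (seqEdge-sym (cvtx C) (path-edge (inject₁ i))) (path-edge (suc i))
    ... | inj₁ refl        = predecessor-on-path _ e
    ... | inj₂ (inj₁ refl) = predecessor-on-path _ e
    ... | inj₂ (inj₂ eq)   = contradiction
      (distinct P (inject₁ (inject₁ i)) (suc (suc i)) eq) (inject₁²≢suc² i)

-- Circulant graphs.

does⇒ : {B : Set} (b? : Dec B) → does b? ≡ true → B
does⇒ (yes b) _ = b

-- Addition of 1 modulo `suc r`.
rotate : ∀ {r} → Fin (suc r) → Fin (suc r)
rotate i with view i
... | ‵fromℕ     = zero
... | ‵inject₁ j = suc j

rotate⁻¹ : ∀ {r} → Fin (suc r) → Fin (suc r)
rotate⁻¹ zero    = fromℕ _
rotate⁻¹ (suc j) = inject₁ j

rotate-fromℕ : ∀ r → rotate (fromℕ r) ≡ zero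
rotate-fromℕ r rewrite view-fromℕ r = refl

rotate-inject₁ : ∀ {r} (j : Fin r) → rotate (inject₁ j) ≡ suc j
rotate-inject₁ j rewrite view-inject₁ j = refl

rotation : ∀ r → Permutation′ (suc r)
rotation r = permutation rotate rotate⁻¹ rotate-rotate⁻¹ rotate⁻¹-rotate
  where
  rotate-rotate⁻¹ : ∀ i → rotate (rotate⁻¹ i) ≡ i
  rotate-rotate⁻¹ zero    = rotate-fromℕ r
  rotate-rotate⁻¹ (suc j) = rotate-inject₁ j
  rotate⁻¹-rotate : ∀ i → rotate⁻¹ (rotate i) ≡ i
  rotate⁻¹-rotate i with view i
  ... | ‵fromℕ     = refl
  ... | ‵inject₁ j = refl

-- Modulo r + 1, b lies in {a + 1, …, a + k}; the second case wraps around.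
Forward : ℕ → ℕ → ℕ → ℕ → Set
Forward k r a b = (a < b × b ≤ a + k) ⊎ b + suc r ≤ a + k

forward? : ∀ k r → Decidable (Forward k r)
forward? k r a b = (a <? b ×-dec b ≤? a + k) ⊎-dec b + suc r ≤? a + k

Close : ℕ → ℕ → ℕ → ℕ → Set
Close k r a b = Forward k r a b ⊎ Forward k r b a

close? : ∀ k r → Decidable (Close k r)
close? k r a b = forward? k r a b ⊎-dec forward? k r b a

-- The circulant graph on ℤ/(r + 1) with connection set {±1, …, ±k}.
module _ {k r : ℕ} (k≤r : k ≤ r) where

  forward-irrefl : ∀ {a} → ¬ Forward k r a a
  forward-irrefl (inj₁ (a<a , _)) = <-irrefl refl a<a
  forward-irrefl {a} (inj₂ p)     = <⇒≱ (s≤s k≤r) (+-cancelˡ-≤ a _ _ p)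

  circulant : Graph
  circulant = record
    { n          = suc r
    ; adj        = λ u v → does (close? k r (toℕ u) (toℕ v))
    ; adj-sym    = λ u v → Bool.∨-comm (does (forward? k r (toℕ u) (toℕ v))) _
    ; adj-irrefl = λ v → dec-false (close? k r (toℕ v) (toℕ v)) λ where
        (inj₁ f) → forward-irrefl f
        (inj₂ f) → forward-irrefl f
    }

  close⇒adj : ∀ u v → Close k r (toℕ u) (toℕ v) → Adj circulant u v
  close⇒adj u v = dec-true (close? k r (toℕ u) (toℕ v))

  adj⇒close : ∀ u v → Adj circulant u v → Close k r (toℕ u) (toℕ v)
  adj⇒close u v = does⇒ (close? k r (toℕ u) (toℕ v))

  -- Rotation takes the last position to 0 and so interchanges the direct and the wrapping case of
  -- `Forward`. This lemma and `forward-to-last` treat these crossings; away from them `forward-suc`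
  -- keeps each case.
  forward-from-last : ∀ {b} → b < r → Forward k r r b ⇔ Forward k r 0 (suc b)
  forward-from-last {b} b<r = mk⇔
    (λ { (inj₁ (r<b , _)) → contradiction b<r (<⇒≯ r<b)
       ; (inj₂ p) → inj₁ (s≤s z≤n , +-cancelˡ-≤ r _ _ (subst (_≤ r + k) b+1+r≡r+1+b p)) })
    (λ { (inj₁ (_ , p)) → inj₂ (subst (_≤ r + k) (sym b+1+r≡r+1+b) (+-monoʳ-≤ r p))
       ; (inj₂ p) → contradiction (≤-trans (m≤n+m (suc r) (suc b)) p) (<⇒≱ (s≤s k≤r)) })
    where
    b+1+r≡r+1+b : b + suc r ≡ r + suc b
    b+1+r≡r+1+b = trans (+-suc b r) (trans (cong suc (+-comm b r)) (sym (+-suc r b)))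

  forward-to-last : ∀ {a} → a < r → Forward k r a r ⇔ Forward k r (suc a) 0
  forward-to-last {a} a<r = mk⇔
    (λ { (inj₁ (_ , p)) → inj₂ (s≤s p)
       ; (inj₂ p) → contradiction p (<⇒≱ (+-mono-< a<r (s≤s k≤r))) })
    (λ { (inj₁ (() , _))
       ; (inj₂ (s≤s p)) → inj₁ (a<r , p) })

  forward-suc : ∀ {a b} → Forward k r a b ⇔ Forward k r (suc a) (suc b)
  forward-suc = mk⇔
    (λ { (inj₁ (p , q)) → inj₁ (s≤s p , s≤s q) ; (inj₂ p) → inj₂ (s≤s p) })
    (λ { (inj₁ (s≤s p , s≤s q)) → inj₁ (p , q) ; (inj₂ (s≤s p)) → inj₂ p })

  forward-rotate : ∀ (i j : Fin (suc r)) →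
    Forward k r (toℕ i) (toℕ j) ⇔ Forward k r (toℕ (rotate i)) (toℕ (rotate j))
  forward-rotate i j with view i | view j
  ... | ‵fromℕ | ‵fromℕ =
    mk⇔ (λ f → contradiction f forward-irrefl) (λ f → contradiction f forward-irrefl)
  ... | ‵fromℕ | ‵inject₁ j rewrite toℕ-fromℕ r | toℕ-inject₁ j = forward-from-last (toℕ<n j)
  ... | ‵inject₁ i | ‵fromℕ rewrite toℕ-fromℕ r | toℕ-inject₁ i = forward-to-last (toℕ<n i)
  ... | ‵inject₁ i | ‵inject₁ j rewrite toℕ-inject₁ i | toℕ-inject₁ j = forward-suc

  rotation-automorphism : IsAutomorphism circulant (rotation r)
  rotation-automorphism i j = sym (does-⇔ (forward-rotate i j ⊎-⇔ forward-rotate j i)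
    (close? k r _ _) (close? k r _ _))

  circulant-connected : 1 ≤ k → Connected circulant
  circulant-connected 1≤k u v = reach-trans (reach-sym (from-zero u)) (from-zero v)
    where
    reach-trans : ∀ {a b c} → Reach circulant a b → Reach circulant b c → Reach circulant a c
    reach-trans here       q = q
    reach-trans (step e p) q = step e (reach-trans p q)
    reach-sym : ∀ {a b} → Reach circulant a b → Reach circulant b a
    reach-sym here       = here
    reach-sym (step {u} {w} e p) =
      reach-trans (reach-sym p) (step (adj-symmetric {circulant} {u} {w} e) here)
    from-zero : ∀ v → Reach circulant zero v
    from-zero = <-weakInduction (Reach circulant zero) here λ i p → reach-trans p
      (step (close⇒adj (inject₁ i) (suc i) (inj₁ (inj₁ (subst (_< suc (toℕ i)) (sym (toℕ-inject₁ i)) (n<1+n (toℕ i)) ,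
        subst (λ a → suc (toℕ i) ≤ a + k) (sym (toℕ-inject₁ i))
          (subst (_≤ toℕ i + k) (+-comm (toℕ i) 1) (+-monoʳ-≤ (toℕ i) 1≤k)))))) here)

  -- Powers of the rotation take 0 to any vertex; undoing the one for `u` and applying the one for
  -- `v` takes `u` to `v`.
  circulant-vertexTransitive : VertexTransitive circulant
  circulant-vertexTransitive u v =
    let ρ , autρ , ρ0≡u = from-zero u
        σ , autσ , σ0≡v = from-zero v
    in flip ρ ∘ₚ σ
     , (λ x y → trans (autσ _ _) (IsAutomorphism-flip {circulant} ρ autρ x y))
     , trans (cong (σ ⟨$⟩ʳ_) (trans (cong (ρ ⟨$⟩ˡ_) (sym ρ0≡u)) (inverseˡ ρ))) σ0≡v
    where
    from-zero : ∀ v → Σ (Permutation′ (suc r)) λ σ → IsAutomorphism circulant σ × σ ⟨$⟩ʳ zero ≡ v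
    from-zero = <-weakInduction _ (id , (λ _ _ → refl) , refl) λ { i (σ , aut , eq) →
      σ ∘ₚ rotation r , (λ x y → trans (rotation-automorphism (σ ⟨$⟩ʳ x) (σ ⟨$⟩ʳ y)) (aut x y)) ,
      trans (cong rotate eq) (rotate-inject₁ i) }

-- An induced path with a trapped end.

-- With k = 2 + N and L = (2 + m) k, the path k - 1, k, 2k, …, L, L + 1 of length 3 + m in ℤ/(L + 3).
module _ (m N : ℕ) where

  private
    k L : ℕ
    k = 2 + N
    L = (2 + m) * k

    k≤L : k ≤ L
    k≤L = m≤m+n k ((1 + m) * k)

    k≤2+L : k ≤ 2 + L
    k≤2+L = m≤n⇒m≤o+n 2 k≤L

    Cls : ℕ → ℕ → Set
    Cls = Close k (2 + L)

  trapGraph : Graph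
  trapGraph = circulant k≤2+L

  trapGraph-connected : Connected trapGraph
  trapGraph-connected = circulant-connected k≤2+L (s≤s z≤n)

  trapGraph-vertexTransitive : VertexTransitive trapGraph
  trapGraph-vertexTransitive = circulant-vertexTransitive k≤2+L

  -- The minimum only affects the last position, where it replaces `(3 + m) * k` by `suc L`.
  pos : ℕ → ℕ
  pos zero    = suc N
  pos (suc i) = (suc i * k) ⊓ suc L

  pos≤1+L : ∀ i → pos i ≤ suc L
  pos≤1+L zero    = ≤-trans (n≤1+n (suc N)) (m≤n⇒m≤1+n k≤L)
  pos≤1+L (suc i) = m⊓n≤n (suc i * k) (suc L)

  1+N≤pos : ∀ i → suc N ≤ pos i
  1+N≤pos zero    = ≤-refl
  1+N≤pos (suc i) = ⊓-glb (≤-trans (n≤1+n (suc N)) (m≤m+n k (i * k)))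
    (≤-trans (n≤1+n (suc N)) (m≤n⇒m≤1+n k≤L))

  *k≤L : ∀ {i} → i ≤ 2 + m → i * k ≤ L
  *k≤L = *-monoˡ-≤ k

  pos-interior : ∀ {i} → i ≤ 1 + m → pos (suc i) ≡ suc i * k
  pos-interior i≤1+m = m≤n⇒m⊓n≡m (m≤n⇒m≤1+n (*k≤L (s≤s i≤1+m)))

  pos-end : pos (3 + m) ≡ suc L
  pos-end = m≥n⇒m⊓n≡n (+-monoˡ-≤ L {1} {k} (s≤s z≤n))

  pos-step-< : ∀ {i} → i < 3 + m → pos i < pos (suc i)
  pos-step-< {zero}  _ = ≤-trans (m≤m+n k 0) (≤-reflexive (sym (pos-interior {0} z≤n)))
  pos-step-< {suc i} (s≤s (s≤s i≤1+m)) = ≤-<-trans (≤-reflexive (pos-interior i≤1+m))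
    (⊓-glb (+-monoˡ-≤ (suc i * k) {1} {k} (s≤s z≤n)) (s≤s (*k≤L (s≤s i≤1+m))))

  pos-step-≤ : ∀ {i} → i < 3 + m → pos (suc i) ≤ pos i + k
  pos-step-≤ {zero}  _ = begin
    pos 1     ≡⟨ pos-interior z≤n ⟩
    k + 0     ≡⟨ +-identityʳ k ⟩
    k         ≤⟨ m≤n+m k (suc N) ⟩
    suc N + k ∎
    where open ≤-Reasoning
  pos-step-≤ {suc i} (s≤s (s≤s i≤1+m)) = begin
    pos (2 + i)     ≤⟨ m⊓n≤m ((2 + i) * k) (suc L) ⟩
    k + suc i * k   ≡⟨ +-comm k (suc i * k) ⟩
    suc i * k + k   ≡⟨ cong (_+ k) (pos-interior i≤1+m) ⟨
    pos (suc i) + k ∎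
    where open ≤-Reasoning

  -- Two successive steps add up to `k + 1` at either end of the path and to `2 * k` elsewhere.
  pos-skip : ∀ {i} → i ≤ 1 + m → pos i + k < pos (2 + i)
  pos-skip {zero}  _ = begin-strict
    suc N + k   <⟨ +-monoʳ-≤ k {k} {k + 0} (m≤m+n k 0) ⟩
    k + (k + 0) ≡⟨ pos-interior (s≤s z≤n) ⟨
    pos 2       ∎
    where open ≤-Reasoning
  pos-skip {suc i} (s≤s i≤m) = begin-strict
    pos (suc i) + k ≡⟨ cong (_+ k) (pos-interior (m≤n⇒m≤1+n i≤m)) ⟩
    suc i * k + k   ≡⟨ +-comm (suc i * k) k ⟩
    (2 + i) * k     <⟨ ⊓-glb (+-monoˡ-≤ ((2 + i) * k) {1} {k} (s≤s z≤n)) (s≤s (*k≤L (s≤s (s≤s i≤m)))) ⟩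
    pos (3 + i)     ∎
    where open ≤-Reasoning

  pos-mono-< : ∀ {i j} → i < j → j ≤ 3 + m → pos i < pos j
  pos-mono-< {i} {suc j} i<1+j 1+j≤3+m with m≤n⇒m<n∨m≡n (s≤s⁻¹ i<1+j)
  ... | inj₂ refl = pos-step-< 1+j≤3+m
  ... | inj₁ i<j  = <-trans (pos-mono-< i<j (<⇒≤ 1+j≤3+m)) (pos-step-< 1+j≤3+m)

  pos-far : ∀ {i j} → 2 + i ≤ j → j ≤ 3 + m → pos i + k < pos j
  pos-far {i} {j} 2+i≤j j≤3+m with m≤n⇒m<n∨m≡n 2+i≤j
  ... | inj₂ refl = pos-skip (s≤s⁻¹ (s≤s⁻¹ j≤3+m))
  ... | inj₁ 2+i<j = <-trans (pos-skip (s≤s⁻¹ (s≤s⁻¹ (≤-trans 2+i≤j j≤3+m)))) (pos-mono-< 2+i<j j≤3+m)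

  pos-close : ∀ {i j} → i < j → j ≤ 3 + m → Cls (pos i) (pos j) → j ≡ suc i
  pos-close {i} {j} i<j j≤3+m close with m≤n⇒m<n∨m≡n i<j
  ... | inj₂ 1+i≡j = sym 1+i≡j
  ... | inj₁ 2+i≤j = contradiction close λ where
      (inj₁ (inj₁ (_ , p))) → <⇒≱ (pos-far 2+i≤j j≤3+m) p
      (inj₁ (inj₂ p))       → <⇒≱ (+-mono-< (pos-mono-< i<j j≤3+m) (s≤s k≤2+L)) p
      (inj₂ (inj₁ (p , _))) → <⇒≯ (pos-mono-< i<j j≤3+m) p
      (inj₂ (inj₂ p))       → <⇒≱ (wrap-gap (1+N≤pos i) (pos≤1+L j)) p
    where
    -- Going on round the circle from `b` to `a` takes at least
    -- `(k - 1) + (L + 3) - (L + 1) = k + 1`, just too far for an edge. This is what the 3 in the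
    -- order `L + 3` provides.
    wrap-gap : ∀ {a b} → suc N ≤ a → b ≤ suc L → b + k < a + (3 + L)
    wrap-gap {a} {b} 1+N≤a b≤1+L = ≤-trans (s≤s (+-monoˡ-≤ k b≤1+L))
      (subst (_≤ a + (3 + L)) (eq N L) (+-monoˡ-≤ (3 + L) 1+N≤a))
      where
      eq : ∀ N L → suc N + (3 + L) ≡ suc (suc L + (2 + N))
      eq = solve-∀

  private
    at : Fin (4 + m) → V trapGraph
    at i = fromℕ< (m≤n⇒m≤1+n (s≤s (pos≤1+L (toℕ i))))

    toℕ-at : ∀ i → toℕ (at i) ≡ pos (toℕ i)
    toℕ-at i = toℕ-fromℕ< _

    toℕ-at-inject₁ : ∀ i → toℕ (at (inject₁ i)) ≡ pos (toℕ i)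
    toℕ-at-inject₁ i = trans (toℕ-at (inject₁ i)) (cong pos (toℕ-inject₁ i))

    bound : ∀ (i : Fin (4 + m)) → toℕ i ≤ 3 + m
    bound i = s≤s⁻¹ (toℕ<n i)

    consecutive : ∀ i j → toℕ j ≡ suc (toℕ i) → SeqEdge {trapGraph} (3 + m) at (at i) (at j)
    consecutive i (suc j) eq = j , inj₁
      (cong at (toℕ-injective (trans (sym (suc-injective eq)) (sym (toℕ-inject₁ j)))) , refl)

  pos-injective : ∀ {i j} → i ≤ 3 + m → j ≤ 3 + m → pos i ≡ pos j → i ≡ j
  pos-injective {i} {j} i≤ j≤ eq with <-cmp i j
  ... | tri< i<j _ _ = contradiction eq (<⇒≢ (pos-mono-< i<j j≤))
  ... | tri≈ _ i≡j _ = i≡j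
  ... | tri> _ _ j<i = contradiction (sym eq) (<⇒≢ (pos-mono-< j<i i≤))

  trapPath : Path trapGraph (3 + m)
  trapPath = record
    { vtx      = at
    ; distinct = λ i j eq → toℕ-injective (pos-injective (bound i) (bound j)
        (trans (sym (toℕ-at i)) (trans (cong toℕ eq) (toℕ-at j))))
    ; edges    = λ i → close⇒adj k≤2+L (at (inject₁ i)) (at (suc i)) (subst₂ Cls
        (sym (toℕ-at-inject₁ i)) (sym (toℕ-at (suc i)))
        (inj₁ (inj₁ (pos-step-< (toℕ<n i) , pos-step-≤ (toℕ<n i)))))
    }

  trapPath-induced : InducedPath trapPath
  trapPath-induced i j a with close ← subst₂ Cls (toℕ-at i) (toℕ-at j) (adj⇒close k≤2+L (at i) (at j) a)
                         | <-cmp (toℕ i) (toℕ j)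
  ... | tri< i<j _ _ = consecutive i j (pos-close i<j (bound j) close)
  ... | tri≈ _ i≡j _ = contradiction (cong at (toℕ-injective i≡j)) (adj⇒≢ {trapGraph} a)
  ... | tri> _ _ j<i = seqEdge-sym {trapGraph} at (consecutive j i (pos-close j<i (bound i) (swap close)))

  -- The neighbours of the end `L + 1` are `L + 2` and those from `L + 1 - k` to `L - 1`, all
  -- adjacent to `L`; the predecessor `L`; and, past the wrap, `0, …, k - 2`, adjacent to `k`. Both
  -- `k` and `L` are interior.
  trapPath-trapped : ∀ y → Adj trapGraph (at (fromℕ (3 + m))) y →
    y ≡ at (inject₁ (fromℕ (2 + m))) ⊎ ∃ λ i → Adj trapGraph y (at (suc (inject₁ i)))
  trapPath-trapped y a = go (subst (λ x → Cls x (toℕ y)) end (adj⇒close k≤2+L (at (fromℕ (3 + m))) y a))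
    where
    end : toℕ (at (fromℕ (3 + m))) ≡ suc L
    end = trans (toℕ-at (fromℕ (3 + m))) (trans (cong pos (toℕ-fromℕ (3 + m))) pos-end)
    last : toℕ (at (inject₁ (fromℕ (2 + m)))) ≡ L
    last = trans (toℕ-at (inject₁ (fromℕ (2 + m)))) (trans
      (cong pos (trans (toℕ-inject₁ (fromℕ (2 + m))) (toℕ-fromℕ (2 + m)))) (pos-interior ≤-refl))
    first : toℕ (at (suc zero)) ≡ k
    first = trans (toℕ-at (suc zero)) (trans (pos-interior z≤n) (+-identityʳ k))
    near-last : Cls (toℕ y) L → ∃ λ i → Adj trapGraph y (at (suc (inject₁ i)))
    near-last c = fromℕ (1 + m) , close⇒adj k≤2+L y (at (inject₁ (fromℕ (2 + m)))) (subst (Cls (toℕ y)) (sym last) c)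
    near-first : Cls (toℕ y) k → ∃ λ i → Adj trapGraph y (at (suc (inject₁ i)))
    near-first c = zero , close⇒adj k≤2+L y (at (suc zero)) (subst (Cls (toℕ y)) (sym first) c)
    go : Cls (suc L) (toℕ y) → y ≡ at (inject₁ (fromℕ (2 + m))) ⊎ ∃ λ i → Adj trapGraph y (at (suc (inject₁ i)))
    go (inj₁ (inj₁ (1+L<y , _))) = inj₂ (near-last (inj₂ (inj₁ (<-trans (n<1+n L) 1+L<y ,
      ≤-trans (s≤s⁻¹ (toℕ<n y)) (subst (2 + L ≤_) (+-comm k L) (+-monoˡ-≤ L {2} {k} (s≤s (s≤s z≤n))))))))
    go (inj₁ (inj₂ p)) = inj₂ (near-first (inj₁ (inj₁ (y<k , m≤n+m k (toℕ y)))))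
      where
      y<k : toℕ y < k
      y<k = +-cancelʳ-≤ (suc L) _ _ (subst₂ _≤_ (+-suc (toℕ y) (suc L)) (+-comm (suc L) k)
        (≤-trans (+-monoʳ-≤ (toℕ y) (n≤1+n (2 + L))) p))
    go (inj₂ (inj₁ (y<1+L , p))) with m≤n⇒m<n∨m≡n (s≤s⁻¹ y<1+L)
    ... | inj₁ y<L = inj₂ (near-last (inj₁ (inj₁ (y<L , ≤-trans (n≤1+n L) p))))
    ... | inj₂ y≡L = inj₁ (toℕ-injective (trans y≡L (sym last)))
    go (inj₂ (inj₂ p)) = contradiction p (<⇒≱ (≤-trans (+-mono-≤ (toℕ<n y) k≤L)
      (≤-trans (≤-reflexive (+-comm (3 + L) L)) (n≤1+n (L + (3 + L))))))

-- Infinitely many graphs up to isomorphism are obtained as graphs of unbounded order; the bound `N`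
-- enters through `k`.
long-path-not-closing : ∀ ℓ → 3 ≤ ℓ → ∀ N → Σ Graph λ G → N ≤ n G × Connected G × VertexTransitive G ×
  Σ (Path G ℓ) λ P → InducedPath P × ¬ ClosesToInducedCycle P
long-path-not-closing 1 (s≤s ())
long-path-not-closing 2 (s≤s (s≤s ()))
long-path-not-closing (suc (suc (suc m))) _ N =
  trapGraph m N , N≤n , trapGraph-connected m N , trapGraph-vertexTransitive m N ,
  trapPath m N , trapPath-induced m N , trapped-end⇒¬closes (trapPath m N) (trapPath-trapped m N)
  where
  N≤n : N ≤ 3 + (2 + m) * (2 + N)
  N≤n = m≤n⇒m≤o+n 3 (≤-trans (m≤n+m N 2) (m≤m+n (2 + N) _))

theorem1p7 : ((G : Graph) → Connected G → VertexTransitive G → 3 ≤ n G →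
    (ℓ : ℕ) → ℓ ≤ 2 → (P : Path G ℓ) → InducedPath P → ClosesToInducedCycle P)
    ×
    ((ℓ : ℕ) → 3 ≤ ℓ → (N : ℕ) →
    Σ Graph λ G → N ≤ n G × Connected G × VertexTransitive G ×
    Σ (Path G ℓ) λ P → InducedPath P × ¬ ClosesToInducedCycle P)
theorem1p7 = (λ G connected vt 3≤n → short-path-closes connected vt 3≤n) , long-path-not-closing
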